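{- Let $\gamma \geq 0$ be an integer. The vector space of nonempty words on $\{0\} \cup [\gamma]$ containing exactly one occurrence of $0$, endowed with the linear operations $\dashv_a, \vdash_a$, $a \in [\gamma]$, satisfying for all such words $u$ and $v$ $$u \dashv_a v := u\, \mathrm{h}_a(v) \qquad \text{and} \qquad u \vdash_a v := \mathrm{h}_a(u)\, v$$ (concatenation of words), is the free $\gamma$-pluriassociative algebra over one generator.
   Context: The ground field has characteristic zero; $[\gamma] = \{1, \dots, \gamma\}$. For a word $u$ and $a \in [\gamma]$, $\mathrm{h}_a(u)$ is the word obtained by replacing in $u$ every occurrence of a letter smaller than $a$ by $a$. The vector space in question is the linear span of the words considered. A $\gamma$-pluriassociative algebra is a vector space with binary linear operations $\dashv_a, \vdash_a$, $a \in [\gamma]$, satisfying for all elements $x, y, z$ and all $a, a' \in [\gamma]$ (with $a \uparrow a' := \max(a, a')$): $(x \vdash_{a'} y) \dashv_a z = x \vdash_{a'} (y \dashv_a z)$; $(x \dashv_{a \uparrow a'} y) \dashv_a z = x \dashv_a (y \vdash_{a'} z)$; $(x \dashv_{a'} y) \vdash_a z = x \vdash_a (y \vdash_{a \uparrow a'} z)$; $(x \dashv_a y) \dashv_{a \uparrow a'} z = x \dashv_a (y \dashv_{a'} z)$; $(x \vdash_{a'} y) \vdash_a z = x \vdash_{a \uparrow a'} (y \vdash_a z)$. Equivalently, it is an algebra over the operad $\mathsf{Dias}_\gamma$, the operad of words on $\{0\} \cup [\gamma]$ with exactly one $0$ with $u \circ_i v := u_1 \dots u_{i-1} \max(u_i,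 v_1) \dots \max(u_i, v_m) u_{i+1} \dots u_n$, the operations $\dashv_a$ and $\vdash_a$ corresponding to $0a$ and $a0$. Free over one generator is meant in the category of $\gamma$-pluriassociative algebras (morphisms: linear maps commuting with all operations). -}

module Defs where

open import Level using (Level; _⊔_; suc; Setω)
open import Algebra.Apartness.Bundles using (HeytingField; HeytingCommutativeRing)
open import Algebra.Bundles using (CommutativeRing)
import Algebra.Construct.NaturalChoice.Max as Max
import Algebra.Definitions as Definitions
import Algebra.Definitions.RawMonoid as RawMonoidDefinitions
open import Algebra.Module.Bundles using (Module)
open import Algebra.Module.Morphism.Structures using (IsModuleHomomorphism)
open import Algebra.Module.Structures.Biased using (IsModuleFromLeft)
import Algebra.Properties.Ring as RingProperties
open import Data.Bool.Base using (true; false; if_then_else_)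
open import Data.Fin.Base using (Fin; zero) renaming (suc to fsuc)
import Data.Fin.Properties as Fin
open import Data.List.Base using (List; []; _∷_; _++_; map; length; filter; concatMap)
open import Data.List.Properties using (length-++; filter-++; ≡-dec)
open import Data.Nat.Base using (ℕ) renaming (suc to nsuc; _+_ to _+ⁿ_)
open import Data.Nat.Properties using (≡-irrelevant)
open import Data.Product using (∃!; _×_; _,_)
open import Function.Base using (flip)
open import Relation.Binary.Definitions using (DecidableEquality)
open import Relation.Binary.PropositionalEquality
  using (_≡_; refl; sym; trans; cong; cong₂)
open import Relation.Nullary using (¬_; does)
open import Relation.Nullary.Decidable using (map′)

private
  variable
    c ℓ ℓ₁ ℓ₂ m ℓm m′ ℓm′ x : Level

fieldRing : HeytingField c ℓ₁ ℓ₂ → CommutativeRing c ℓ₁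
fieldRing K = HeytingCommutativeRing.commutativeRing (HeytingField.heytingCommutativeRing K)

CharacteristicZero : HeytingField c ℓ₁ ℓ₂ → Set ℓ₁
CharacteristicZero K = ∀ n → ¬ ((nsuc n ×ᴷ 1#) ≈ 0#)
  where
  open CommutativeRing (fieldRing K)
  open RawMonoidDefinitions +-rawMonoid using () renaming (_×_ to _×ᴷ_)

------------------------------------------------------------------------
-- Pluriassociative algebras

-- Fin γ stands for [γ] = {1, …, γ}; only the order of the indices matters here.

_↑_ : ∀ {γ} → Fin γ → Fin γ → Fin γ
_↑_ {γ} = Max._⊔_ (Fin.≤-totalOrder γ)

module _ {R : CommutativeRing c ℓ} where
  open CommutativeRing R using (Carrier)

  record IsBilinear (M : Module R m ℓm)
                    (_∙_ : Module.Carrierᴹ M → Module.Carrierᴹ M → Module.Carrierᴹ M)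
                    : Set (c ⊔ m ⊔ ℓm) where
    open Module M using (Carrierᴹ; _≈ᴹ_; _+ᴹ_; _*ₗ_)
    open Definitions _≈ᴹ_ using (Congruent₂; _DistributesOver_)
    field
      ∙-cong    : Congruent₂ _∙_
      ∙-distrib : _∙_ DistributesOver _+ᴹ_
      ∙-*ₗˡ     : ∀ (k : Carrier) (x y : Carrierᴹ) → ((k *ₗ x) ∙ y) ≈ᴹ (k *ₗ (x ∙ y))
      ∙-*ₗʳ     : ∀ (k : Carrier) (x y : Carrierᴹ) → (x ∙ (k *ₗ y)) ≈ᴹ (k *ₗ (x ∙ y))

  record IsPluriassociative {γ : ℕ} (M : Module R m ℓm)
    (_⊣⟨_⟩_ _⊢⟨_⟩_ : Module.Carrierᴹ M → Fin γ → Module.Carrierᴹ M → Module.Carrierᴹ M)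
    : Set (c ⊔ m ⊔ ℓm) where
    open Module M using (Carrierᴹ; _≈ᴹ_)
    field
      ⊣-bilinear : ∀ a → IsBilinear M (_⊣⟨ a ⟩_)
      ⊢-bilinear : ∀ a → IsBilinear M (_⊢⟨ a ⟩_)

      ⊢-⊣-assoc : ∀ a a′ (x y z : Carrierᴹ) →
        ((x ⊢⟨ a′ ⟩ y) ⊣⟨ a ⟩ z) ≈ᴹ (x ⊢⟨ a′ ⟩ (y ⊣⟨ a ⟩ z))
      ⊣↑-⊣ : ∀ a a′ (x y z : Carrierᴹ) →
        ((x ⊣⟨ a ↑ a′ ⟩ y) ⊣⟨ a ⟩ z) ≈ᴹ (x ⊣⟨ a ⟩ (y ⊢⟨ a′ ⟩ z))
      ⊣-⊢ : ∀ a a′ (x y z : Carrierᴹ) →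
        ((x ⊣⟨ a′ ⟩ y) ⊢⟨ a ⟩ z) ≈ᴹ (x ⊢⟨ a ⟩ (y ⊢⟨ a ↑ a′ ⟩ z))
      ⊣-⊣↑ : ∀ a a′ (x y z : Carrierᴹ) →
        ((x ⊣⟨ a ⟩ y) ⊣⟨ a ↑ a′ ⟩ z) ≈ᴹ (x ⊣⟨ a ⟩ (y ⊣⟨ a′ ⟩ z))
      ⊢-⊢ : ∀ a a′ (x y z : Carrierᴹ) →
        ((x ⊢⟨ a′ ⟩ y) ⊢⟨ a ⟩ z) ≈ᴹ (x ⊢⟨ a ↑ a′ ⟩ (y ⊢⟨ a ⟩ z))

record PluriassociativeAlgebra (R : CommutativeRing c ℓ) (γ : ℕ) (m ℓm : Level)
  : Set (c ⊔ ℓ ⊔ suc (m ⊔ ℓm)) where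
  field
    space              : Module R m ℓm
  open Module space public
  field
    _⊣⟨_⟩_ _⊢⟨_⟩_      : Carrierᴹ → Fin γ → Carrierᴹ → Carrierᴹ
    isPluriassociative : IsPluriassociative space _⊣⟨_⟩_ _⊢⟨_⟩_
  open IsPluriassociative isPluriassociative public

module _ {R : CommutativeRing c ℓ} {γ : ℕ} where

  record IsHomomorphism (A : PluriassociativeAlgebra R γ m ℓm)
                        (B : PluriassociativeAlgebra R γ m′ ℓm′)
                        (φ : PluriassociativeAlgebra.Carrierᴹ A → PluriassociativeAlgebra.Carrierᴹ B)
                        : Set (c ⊔ m ⊔ ℓm ⊔ ℓm′) where
    private
      module A = PluriassociativeAlgebra A
      module B = PluriassociativeAlgebra B
    field
      isLinear : IsModuleHomomorphism A.rawModule B.rawModule φ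
      ⊣-homo   : ∀ a x y → φ (x A.⊣⟨ a ⟩ y) B.≈ᴹ (φ x B.⊣⟨ a ⟩ φ y)
      ⊢-homo   : ∀ a x y → φ (x A.⊢⟨ a ⟩ y) B.≈ᴹ (φ x B.⊢⟨ a ⟩ φ y)

  -- Lives in Setω because the universal property ranges over algebras in all
  -- universes.
  record IsFreeOverOneGenerator (M : Module R m ℓm)
    (_⊣⟨_⟩_ _⊢⟨_⟩_ : Module.Carrierᴹ M → Fin γ → Module.Carrierᴹ M → Module.Carrierᴹ M)
    : Setω where
    field
      isPluriassociative : IsPluriassociative M _⊣⟨_⟩_ _⊢⟨_⟩_

    algebra : PluriassociativeAlgebra R γ m ℓm
    algebra = record { isPluriassociative = isPluriassociative }

    field
      generator : Module.Carrierᴹ M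
      universal : ∀ {m′ ℓm′} (B : PluriassociativeAlgebra R γ m′ ℓm′) →
        let module B = PluriassociativeAlgebra B in
        ∀ (b : B.Carrierᴹ) →
        ∃! (λ (φ ψ : Module.Carrierᴹ M → B.Carrierᴹ) → ∀ x → φ x B.≈ᴹ ψ x)
           (λ φ → IsHomomorphism algebra B φ × (φ generator B.≈ᴹ b))

------------------------------------------------------------------------
-- The linear span of a set X with decidable equality

-- Elements are formal linear combinations, identified when every element of X
-- has the same total coefficient in both.

module _ (R : CommutativeRing c ℓ) {X : Set x} (_≟_ : DecidableEquality X) where
  open CommutativeRing R
    renaming (Carrier to K; refl to ≈-refl; sym to ≈-sym; trans to ≈-trans)
  open RingProperties ring using (-1*x≈-x)

  coeff : X → List (K × X) → K
  coeff x []            = 0#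
  coeff x ((k , y) ∷ v) = if does (x ≟ y) then k + coeff x v else coeff x v

  infix 4 _∼_
  _∼_ : List (K × X) → List (K × X) → Set (ℓ ⊔ x)
  u ∼ v = ∀ x → coeff x u ≈ coeff x v

  scale : K → List (K × X) → List (K × X)
  scale k = map λ (l , y) → k * l , y

  private
    coeff-++ : ∀ x u v → coeff x (u ++ v) ≈ (coeff x u + coeff x v)
    coeff-++ x []            v = ≈-sym (+-identityˡ _)
    coeff-++ x ((k , y) ∷ u) v with does (x ≟ y)
    ... | true  = ≈-trans (+-congˡ (coeff-++ x u v)) (≈-sym (+-assoc _ _ _))
    ... | false = coeff-++ x u v

    coeff-scale : ∀ x k v → coeff x (scale k v) ≈ (k * coeff x v)
    coeff-scale x k []            = ≈-sym (zeroʳ k)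
    coeff-scale x k ((l , y) ∷ v) with does (x ≟ y)
    ... | true  = ≈-trans (+-congˡ (coeff-scale x k v)) (≈-sym (distribˡ _ _ _))
    ... | false = coeff-scale x k v

    coeff-neg : ∀ x v → coeff x (scale (- 1#) v) ≈ (- coeff x v)
    coeff-neg x v = ≈-trans (coeff-scale x (- 1#) v) (-1*x≈-x _)

    ++-cong : ∀ {u u′ v v′} → u ∼ u′ → v ∼ v′ → u ++ v ∼ u′ ++ v′
    ++-cong {u} {u′} {v} {v′} p q x =
      ≈-trans (coeff-++ x u v) (≈-trans (+-cong (p x) (q x)) (≈-sym (coeff-++ x u′ v′)))

    scale-cong : ∀ {k l u v} → k ≈ l → u ∼ v → scale k u ∼ scale l v
    scale-cong {k} {l} {u} {v} p q x =
      ≈-trans (coeff-scale x k u) (≈-trans (*-cong p (q x)) (≈-sym (coeff-scale x l v)))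

    ++-inverseˡ : ∀ v → scale (- 1#) v ++ v ∼ []
    ++-inverseˡ v x =
      ≈-trans (coeff-++ x (scale (- 1#) v) v) (≈-trans (+-congʳ (coeff-neg x v)) (-‿inverseˡ _))

    ++-comm : ∀ u v → u ++ v ∼ v ++ u
    ++-comm u v x =
      ≈-trans (coeff-++ x u v) (≈-trans (+-comm _ _) (≈-sym (coeff-++ x v u)))

    ++-assoc : ∀ u v w → (u ++ v) ++ w ∼ u ++ (v ++ w)
    ++-assoc u v w x =
      ≈-trans (coeff-++ x (u ++ v) w)
      (≈-trans (+-congʳ (coeff-++ x u v))
      (≈-trans (+-assoc _ _ _)
      (≈-trans (+-congˡ (≈-sym (coeff-++ x v w))) (≈-sym (coeff-++ x u (v ++ w))))))

    ++-identityʳ : ∀ v → v ++ [] ∼ v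
    ++-identityʳ v x = ≈-trans (coeff-++ x v []) (+-identityʳ _)

    scale-distribʳ : ∀ v k l → scale (k + l) v ∼ scale k v ++ scale l v
    scale-distribʳ v k l x =
      ≈-trans (coeff-scale x (k + l) v)
      (≈-trans (distribʳ _ _ _)
      (≈-trans (+-cong (≈-sym (coeff-scale x k v)) (≈-sym (coeff-scale x l v)))
               (≈-sym (coeff-++ x (scale k v) (scale l v)))))

    scale-distribˡ : ∀ k u v → scale k (u ++ v) ∼ scale k u ++ scale k v
    scale-distribˡ k u v x =
      ≈-trans (coeff-scale x k (u ++ v))
      (≈-trans (*-congˡ (coeff-++ x u v))
      (≈-trans (distribˡ _ _ _)
      (≈-trans (+-cong (≈-sym (coeff-scale x k u)) (≈-sym (coeff-scale x k v)))
               (≈-sym (coeff-++ x (scale k u) (scale k v))))))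

    scale-assoc : ∀ k l v → scale (k * l) v ∼ scale k (scale l v)
    scale-assoc k l v x =
      ≈-trans (coeff-scale x (k * l) v)
      (≈-trans (*-assoc _ _ _)
      (≈-trans (*-congˡ (≈-sym (coeff-scale x l v))) (≈-sym (coeff-scale x k (scale l v)))))

  Span : Module R (c ⊔ x) (ℓ ⊔ x)
  Span = record
    { Carrierᴹ = List (K × X)
    ; _≈ᴹ_     = _∼_
    ; _+ᴹ_     = _++_
    ; _*ₗ_     = scale
    ; _*ᵣ_     = flip scale
    ; 0ᴹ       = []
    ; -ᴹ_      = scale (- 1#)
    ; isModule = IsModuleFromLeft.isModule {commutativeRing = R} record
      { isLeftModule = record
        { isLeftSemimodule = record
          { +ᴹ-isCommutativeMonoid = record
            { isMonoid = record
              { isSemigroup = record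
                { isMagma = record
                  { isEquivalence = record
                    { refl  = λ _ → ≈-refl
                    ; sym   = λ p x → ≈-sym (p x)
                    ; trans = λ p q x → ≈-trans (p x) (q x)
                    }
                  ; ∙-cong = λ {u} {u′} {v} {v′} → ++-cong {u} {u′} {v} {v′}
                  }
                ; assoc = ++-assoc
                }
              ; identity = (λ _ _ → ≈-refl) , ++-identityʳ
              }
            ; comm = ++-comm
            }
          ; isPreleftSemimodule = record
            { *ₗ-cong      = λ {k} {l} {u} {v} → scale-cong {k} {l} {u} {v}
            ; *ₗ-zeroˡ     = λ v x → ≈-trans (coeff-scale x 0# v) (zeroˡ _)
            ; *ₗ-distribʳ  = scale-distribʳ
            ; *ₗ-identityˡ = λ v x → ≈-trans (coeff-scale x 1# v) (*-identityˡ _)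
            ; *ₗ-assoc     = scale-assoc
            ; *ₗ-zeroʳ     = λ _ _ → ≈-refl
            ; *ₗ-distribˡ  = scale-distribˡ
            }
          }
        ; -ᴹ‿cong    = λ {u} {v} → scale-cong {u = u} {v} ≈-refl
        ; -ᴹ‿inverse = ++-inverseˡ
                     , λ v x → ≈-trans (++-comm v (scale (- 1#) v) x) (++-inverseˡ v x)
        }
      }
    }

  bilinearExtension : (X → X → X) → List (K × X) → List (K × X) → List (K × X)
  bilinearExtension f u v =
    concatMap (λ (k , y) → map (λ (l , z) → k * l , f y z) v) u

------------------------------------------------------------------------
-- Words on {0} ∪ [γ] with exactly one occurrence of 0

-- The letter 0 is zero, and the letter for the index a : Fin γ is fsuc a.

Letter : ℕ → Set
Letter γ = Fin (nsuc γ)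

zeros : ∀ {γ} → List (Letter γ) → ℕ
zeros u = length (filter (Fin._≟ zero) u)

record Word (γ : ℕ) : Set where
  constructor word
  field
    letters : List (Letter γ)
    oneZero : zeros letters ≡ 1

open Word public

_≟ʷ_ : ∀ {γ} → DecidableEquality (Word γ)
u ≟ʷ v = map′ (letters-injective u v) (cong letters) (≡-dec Fin._≟_ (letters u) (letters v))
  where
  letters-injective : ∀ u v → letters u ≡ letters v → u ≡ v
  letters-injective (word _ p) (word _ q) refl = cong (word _) (≡-irrelevant p q)

h : ∀ {γ} → Fin γ → List (Letter γ) → List (Letter γ)
h a = map λ b → if does (b Fin.<? fsuc a) then fsuc a else b

zeros-++ : ∀ {γ} (u v : List (Letter γ)) → zeros (u ++ v) ≡ zeros u +ⁿ zeros v
zeros-++ u v = trans (cong length (filter-++ (Fin._≟ zero) u v)) (length-++ (filter (Fin._≟ zero) u))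

zeros-h : ∀ {γ} (a : Fin γ) (u : List (Letter γ)) → zeros (h a u) ≡ 0
zeros-h a []           = refl
zeros-h a (zero ∷ u)   = zeros-h a u
zeros-h a (fsuc b ∷ u) with does (fsuc b Fin.<? fsuc a)
... | true  = zeros-h a u
... | false = zeros-h a u

_⊣ʷ⟨_⟩_ : ∀ {γ} → Word γ → Fin γ → Word γ → Word γ
u ⊣ʷ⟨ a ⟩ v = word (letters u ++ h a (letters v))
  (trans (zeros-++ (letters u) _) (cong₂ _+ⁿ_ (oneZero u) (zeros-h a (letters v))))

_⊢ʷ⟨_⟩_ : ∀ {γ} → Word γ → Fin γ → Word γ → Word γ
u ⊢ʷ⟨ a ⟩ v = word (h a (letters u) ++ letters v)
  (trans (zeros-++ (h a (letters u)) _) (cong₂ _+ⁿ_ (zeros-h a (letters u)) (oneZero v)))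

module _ (R : CommutativeRing c ℓ) (γ : ℕ) where

  WordSpace : Module R c ℓ
  WordSpace = Span R (_≟ʷ_ {γ})

  open Module WordSpace using (Carrierᴹ)

  wordLeft wordRight : Carrierᴹ → Fin γ → Carrierᴹ → Carrierᴹ
  wordLeft  u a v = bilinearExtension R _≟ʷ_ (_⊣ʷ⟨ a ⟩_) u v
  wordRight u a v = bilinearExtension R _≟ʷ_ (_⊢ʷ⟨ a ⟩_) u v

{-# OPTIONS --safe #-}
-- A word u₁ … uₖ 0 v₁ … vₙ is the value of u₁ ⊢ (… (uₖ ⊢ ((0 ⊣ v₁) … ⊣ vₙ))) at the generator 0,
-- where each ⊢, ⊣ is indexed by the letter and has the generator as its other argument. Hence a
-- homomorphism out of the word algebra is determined by the image b of 0. Conversely, evaluating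
-- these expressions at b and extending linearly gives a homomorphism, because the five axioms
-- rewrite a product of two such expressions into one, raising letters exactly as h does.
module Submission where

open import Defs
open import Level using (Level; _⊔_)
open import Algebra.Apartness.Bundles using (HeytingField)
open import Algebra.Bundles using (CommutativeMonoid; CommutativeRing)
import Algebra.Construct.NaturalChoice.Max as Max
open import Algebra.Module.Bundles using (Module)
open import Algebra.Module.Morphism.Structures using (IsModuleHomomorphism)
import Algebra.Module.Properties.LeftModule as LeftModuleProperties
import Algebra.Properties.CommutativeSemigroup as CommutativeSemigroupProperties
open import Data.Bool.Base using (true; false; if_then_else_)
open import Data.Fin.Base using (Fin; zero) renaming (suc to fsuc; _<_ to _<ᶠ_)
import Data.Fin.Properties as Fin
open import Data.List.Base using (List; []; _∷_; _++_; [_]; map; length; filter)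
open import Data.List.Properties
  using (++-assoc; ++-identityʳ; map-++; concatMap-++; filter-notAll)
open import Data.List.Relation.Unary.Any using (here)
open import Data.Nat.Base using (ℕ; _<_; s≤s; s≤s⁻¹)
open import Data.Nat.Induction using (Acc; acc; <-wellFounded)
open import Data.Nat.Properties using (≡-irrelevant; suc-injective; <⇒≤; ≮⇒≥)
open import Data.Product using (_×_; _,_; proj₁; proj₂)
open import Function.Base using (_∘_)
open import Relation.Binary.Bundles using (Setoid)
open import Relation.Binary.Definitions using (DecidableEquality)
open import Relation.Binary.PropositionalEquality
  using (_≡_; _≢_; refl; sym; trans; cong; cong₂; module ≡-Reasoning)
import Relation.Binary.Reasoning.Setoid as ≈-Reasoning
open import Relation.Nullary using (Dec; does; yes; no; ¬?; contradiction)
open import Relation.Nullary.Decidable using (dec-true; dec-false)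

private
  variable
    c ℓ ℓ₁ ℓ₂ m ℓm x : Level

-- Spans of sets

module _ (R : CommutativeRing c ℓ) {X : Set x} (_≟_ : DecidableEquality X) where
  open CommutativeRing R using (_≈_; _+_; _*_; 0#; 1#; *-assoc; *-congˡ; *-identityʳ)
    renaming (Carrier to K; refl to ≈-refl; sym to ≈-sym; trans to ≈-trans;
              +-cong to +ᴷ-cong; reflexive to ≈-reflexive)
  open CommutativeSemigroupProperties (CommutativeRing.*-commutativeSemigroup R) using (x∙yz≈y∙xz)
  private
    Formal : Set _
    Formal = List (K × X)

    infix 4 _≈ᵛ_
    _≈ᵛ_ : Formal → Formal → Set _
    _≈ᵛ_ = _∼_ R _≟_

    module V = Module (Span R _≟_)

  without : X → Formal → Formal
  without x = filter λ p → ¬? (x ≟ proj₂ p)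

  coeff-without-self : ∀ x u → coeff R _≟_ x (without x u) ≡ 0#
  coeff-without-self x []            = refl
  coeff-without-self x ((k , y) ∷ u) with does (x ≟ y) in eq
  ... | true  = coeff-without-self x u
  -- The filter has kept the term, so `coeff` tests the same equality a second time; the recorded
  -- `eq` decides it.
  ... | false rewrite eq = coeff-without-self x u

  coeff-without-other : ∀ {x y} → x ≢ y → ∀ u → coeff R _≟_ y (without x u) ≡ coeff R _≟_ y u
  coeff-without-other x≢y []            = refl
  coeff-without-other {x} {y} x≢y ((k , z) ∷ u) with x ≟ z | y ≟ z in eq
  ... | yes x≡z | yes y≡z = contradiction (trans x≡z (sym y≡z)) x≢y
  ... | yes _   | no _    = coeff-without-other x≢y u
  ... | no _    | yes _   rewrite eq = cong (k +_) (coeff-without-other x≢y u)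
  ... | no _    | no _    rewrite eq = coeff-without-other x≢y u

  without-null : ∀ x {u} → u ≈ᵛ [] → without x u ≈ᵛ []
  without-null x {u} u≈0 y with x ≟ y
  ... | yes refl = ≈-reflexive (coeff-without-self x u)
  ... | no x≢y   = ≈-trans (≈-reflexive (coeff-without-other x≢y u)) (u≈0 y)

  ∷-cong : ∀ {k l x y u v} → k ≈ l → x ≡ y → u ≈ᵛ v → (k , x) ∷ u ≈ᵛ (l , y) ∷ v
  ∷-cong {x = x} k≈l refl u≈v z with does (z ≟ x)
  ... | true  = +ᴷ-cong k≈l (u≈v z)
  ... | false = u≈v z

  module _ (M : Module R m ℓm) where
    open Module M
    open LeftModuleProperties leftModule using (inverseˡ-uniqueᴹ)
    open CommutativeRing R using (-_; -‿inverseˡ)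

    -- Negation in the span is by definition scaling by `- 1#`, so a linear map into `M` respects
    -- negation by way of this identity.
    -1*ₗ : ∀ x → (- 1#) *ₗ x ≈ᴹ -ᴹ x
    -1*ₗ x = inverseˡ-uniqueᴹ _ _ (begin
      (- 1#) *ₗ x +ᴹ x         ≈⟨ +ᴹ-congˡ (*ₗ-identityˡ x) ⟨
      (- 1#) *ₗ x +ᴹ 1# *ₗ x   ≈⟨ *ₗ-distribʳ x (- 1#) 1# ⟨
      ((- 1#) + 1#) *ₗ x       ≈⟨ *ₗ-congʳ (-‿inverseˡ 1#) ⟩
      0# *ₗ x                  ≈⟨ *ₗ-zeroˡ x ⟩
      0ᴹ                       ∎)
      where open ≈-Reasoning ≈ᴹ-setoid

  -- Linear extension of a map on the basis

  module LinearExtension (M : Module R m ℓm) (f : X → Module.Carrierᴹ M) where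
    open Module M
    open CommutativeRing R using (-_)
    open CommutativeSemigroupProperties (CommutativeMonoid.commutativeSemigroup +ᴹ-commutativeMonoid)
      using () renaming (x∙yz≈y∙xz to x+yz≈y+xz)
    open ≈-Reasoning ≈ᴹ-setoid

    extend : Formal → Carrierᴹ
    extend []            = 0ᴹ
    extend ((k , x) ∷ u) = k *ₗ f x +ᴹ extend u

    extend-++ : ∀ u v → extend (u ++ v) ≈ᴹ extend u +ᴹ extend v
    extend-++ []      v = ≈ᴹ-sym (+ᴹ-identityˡ _)
    extend-++ (_ ∷ u) v = ≈ᴹ-trans (+ᴹ-congˡ (extend-++ u v)) (≈ᴹ-sym (+ᴹ-assoc _ _ _))

    extend-scale : ∀ k u → extend (scale R _≟_ k u) ≈ᴹ k *ₗ extend u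
    extend-scale k []            = ≈ᴹ-sym (*ₗ-zeroʳ k)
    extend-scale k ((l , x) ∷ u) =
      ≈ᴹ-trans (+ᴹ-cong (*ₗ-assoc k l (f x)) (extend-scale k u)) (≈ᴹ-sym (*ₗ-distribˡ k _ _))

    extend-neg : ∀ u → extend (V.-ᴹ u) ≈ᴹ -ᴹ extend u
    extend-neg u = ≈ᴹ-trans (extend-scale (- 1#) u) (-1*ₗ M (extend u))

    -- Isolates everything that `x` contributes as one multiple of `f x`, so that a vanishing
    -- coefficient at `x` makes the whole contribution vanish.
    extend-split : ∀ x u → extend u ≈ᴹ coeff R _≟_ x u *ₗ f x +ᴹ extend (without x u)
    extend-split x []            = ≈ᴹ-sym (≈ᴹ-trans (+ᴹ-identityʳ _) (*ₗ-zeroˡ _))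
    extend-split x ((k , y) ∷ u) with x ≟ y
    ... | yes refl = begin
      k *ₗ f x +ᴹ extend u                                                 ≈⟨ +ᴹ-congˡ (extend-split x u) ⟩
      k *ₗ f x +ᴹ (coeff R _≟_ x u *ₗ f x +ᴹ extend (without x u))         ≈⟨ +ᴹ-assoc _ _ _ ⟨
      (k *ₗ f x +ᴹ coeff R _≟_ x u *ₗ f x) +ᴹ extend (without x u)         ≈⟨ +ᴹ-congʳ (*ₗ-distribʳ _ _ _) ⟨
      (k + coeff R _≟_ x u) *ₗ f x +ᴹ extend (without x u)                 ∎
    ... | no _     = ≈ᴹ-trans (+ᴹ-congˡ (extend-split x u)) (x+yz≈y+xz _ _ _)

    -- A null combination can be shortened by discarding all terms in one basis element, since they
    -- have total coefficient 0; coefficients themselves cannot be compared, as _≈_ is not decidable.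
    extend-null : ∀ u → Acc _<_ (length u) → u ≈ᵛ [] → extend u ≈ᴹ 0ᴹ
    extend-null []              _        u≈0 = ≈ᴹ-refl
    extend-null u@((_ , x) ∷ _) (acc rs) u≈0 = begin
      extend u                                                ≈⟨ extend-split x u ⟩
      coeff R _≟_ x u *ₗ f x +ᴹ extend (without x u)          ≈⟨ +ᴹ-cong (*ₗ-congʳ (u≈0 x))
                                                                   (extend-null (without x u) (rs shorter) (without-null x {u} u≈0)) ⟩
      0# *ₗ f x +ᴹ 0ᴹ                                         ≈⟨ +ᴹ-identityʳ _ ⟩
      0# *ₗ f x                                               ≈⟨ *ₗ-zeroˡ _ ⟩
      0ᴹ                                                      ∎
      where
      shorter : length (without x u) < length u
      shorter = filter-notAll (λ p → ¬? (x ≟ proj₂ p)) u (here λ x≢x → x≢x refl)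

    -- Since `extend` respects sums and negatives, it suffices to treat the difference of `u` and
    -- `v`, which is null.
    extend-cong : ∀ {u v} → u ≈ᵛ v → extend u ≈ᴹ extend v
    extend-cong {u} {v} u≈v = begin
      extend u                                  ≈⟨ +ᴹ-identityʳ _ ⟨
      extend u +ᴹ 0ᴹ                            ≈⟨ +ᴹ-congˡ (-ᴹ‿inverseˡ (extend v)) ⟨
      extend u +ᴹ ((-ᴹ extend v) +ᴹ extend v)   ≈⟨ +ᴹ-assoc _ _ _ ⟨
      (extend u +ᴹ (-ᴹ extend v)) +ᴹ extend v   ≈⟨ +ᴹ-congʳ (+ᴹ-congˡ (extend-neg v)) ⟨
      (extend u +ᴹ extend (V.-ᴹ v)) +ᴹ extend v ≈⟨ +ᴹ-congʳ (extend-++ u (V.-ᴹ v)) ⟨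
      extend (u ++ (V.-ᴹ v)) +ᴹ extend v        ≈⟨ +ᴹ-congʳ (extend-null (u ++ (V.-ᴹ v)) (<-wellFounded _) u-v≈0) ⟩
      0ᴹ +ᴹ extend v                            ≈⟨ +ᴹ-identityˡ _ ⟩
      extend v                                  ∎
      where
      u-v≈0 : u ++ (V.-ᴹ v) ≈ᵛ []
      u-v≈0 = V.≈ᴹ-trans {u ++ (V.-ᴹ v)} {v ++ (V.-ᴹ v)} {[]}
        (V.+ᴹ-congʳ {V.-ᴹ v} {u} {v} u≈v) (V.-ᴹ‿inverseʳ v)

    extend-isLinear : IsModuleHomomorphism V.rawModule rawModule extend
    extend-isLinear = record { isBimoduleHomomorphism = record
      { +ᴹ-isGroupHomomorphism = record
        { isMonoidHomomorphism = record
          { isMagmaHomomorphism = record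
            { isRelHomomorphism = record { cong = λ {u} {v} → extend-cong {u} {v} }
            ; homo = extend-++
            }
          ; ε-homo = ≈ᴹ-refl
          }
        ; ⁻¹-homo = extend-neg
        }
      ; *ₗ-homo = extend-scale
      ; *ᵣ-homo = λ k u → ≈ᴹ-trans (extend-scale k u) (*ₗ-*ᵣ-coincident k (extend u))
      } }

    extend-unique : ∀ {ψ} → IsModuleHomomorphism V.rawModule rawModule ψ →
      (∀ x → ψ [ 1# , x ] ≈ᴹ f x) → ∀ u → extend u ≈ᴹ ψ u
    extend-unique {ψ} ψ-linear ψ-basis = go
      where
      open IsModuleHomomorphism ψ-linear
      go : ∀ u → extend u ≈ᴹ ψ u
      go []            = ≈ᴹ-sym 0ᴹ-homo
      go ((k , x) ∷ u) = begin
        k *ₗ f x +ᴹ extend u             ≈⟨ +ᴹ-cong (*ₗ-congˡ (ψ-basis x)) (≈ᴹ-sym (go u)) ⟨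
        k *ₗ ψ [ 1# , x ] +ᴹ ψ u         ≈⟨ +ᴹ-congʳ (*ₗ-homo k _) ⟨
        ψ [ k * 1# , x ] +ᴹ ψ u          ≈⟨ +ᴹ-homo _ _ ⟨
        -- Scaling `[ 1# , x ]` by `k` literally produces the coefficient `k * 1#`, which equals `k`
        -- only up to `≈`.
        ψ ((k * 1# , x) ∷ u)             ≈⟨ ⟦⟧-cong (∷-cong {u = u} {u} (*-identityʳ k) refl (λ _ → ≈-refl)) ⟩
        ψ ((k , x) ∷ u)                  ∎

  open LinearExtension using (extend; extend-cong)

  extend-cong-basis : (M : Module R m ℓm) → let open Module M in
    {f g : X → Carrierᴹ} → (∀ x → f x ≈ᴹ g x) → ∀ u → extend M f u ≈ᴹ extend M g u
  extend-cong-basis M f≈g []            = Module.≈ᴹ-refl M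
  extend-cong-basis M f≈g ((k , x) ∷ u) =
    Module.+ᴹ-cong M (Module.*ₗ-congˡ M (f≈g x)) (extend-cong-basis M f≈g u)

  -- Unlike the function _∼_, a record type is injective, so that its arguments can be inferred.
  infix 4 _≋_
  record _≋_ (u v : Formal) : Set (ℓ ⊔ x) where
    constructor ∼⇒≋
    field ≋⇒∼ : u ≈ᵛ v
  open _≋_

  ≋-setoid : Setoid (c ⊔ x) (ℓ ⊔ x)
  ≋-setoid = record
    { Carrier       = Formal
    ; _≈_           = _≋_
    ; isEquivalence = record
      { refl  = ∼⇒≋ λ _ → ≈-refl
      ; sym   = λ (∼⇒≋ p) → ∼⇒≋ λ z → ≈-sym (p z)
      ; trans = λ (∼⇒≋ p) (∼⇒≋ q) → ∼⇒≋ λ z → ≈-trans (p z) (q z)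
      }
    }

  open Setoid ≋-setoid using () renaming (refl to ≋-refl; reflexive to ≋-reflexive)

  ≋-∷ : ∀ {k l x y u v} → k ≈ l → x ≡ y → u ≋ v → (k , x) ∷ u ≋ (l , y) ∷ v
  ≋-∷ {u = u} {v} k≈l x≡y (∼⇒≋ u∼v) = ∼⇒≋ (∷-cong {u = u} {v} k≈l x≡y u∼v)

  ≋-++ : ∀ {u u′ v v′} → u ≋ u′ → v ≋ v′ → u ++ v ≋ u′ ++ v′
  ≋-++ {u} {u′} {v} {v′} (∼⇒≋ p) (∼⇒≋ q) = ∼⇒≋ (V.+ᴹ-cong {u} {u′} {v} {v′} p q)

  -- Bilinear extension of an operation on the basis

  module _ (f : X → X → X) where
    open ≈-Reasoning ≋-setoid

    bilinear : Formal → Formal → Formal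
    bilinear = bilinearExtension R _≟_ f

    -- The block that a single term of the left argument contributes to `bilinear`; inductions on
    -- the left argument peel off one such block at a time.
    row : K × X → Formal → Formal
    row (k , y) = map λ (l , z) → k * l , f y z

    -- Both layers are instances of `extend`, so well-definedness of `bilinear` in each argument is
    -- inherited from `extend-cong`.
    iteratedExtend : Formal → Formal → Formal
    iteratedExtend u v =
      extend (Span R _≟_) (λ y → extend (Span R _≟_) (λ z → [ 1# , f y z ]) v) u

    row≋scale-extend : ∀ k y v →
      row (k , y) v ≋ scale R _≟_ k (extend (Span R _≟_) (λ z → [ 1# , f y z ]) v)
    row≋scale-extend k y []            = ≋-refl
    row≋scale-extend k y ((l , z) ∷ v) =
      ≋-∷ (*-congˡ (≈-sym (*-identityʳ l))) refl (row≋scale-extend k y v)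

    bilinear≋iteratedExtend : ∀ u v → bilinear u v ≋ iteratedExtend u v
    bilinear≋iteratedExtend []            v = ≋-refl
    bilinear≋iteratedExtend ((k , y) ∷ u) v =
      ≋-++ (row≋scale-extend k y v) (bilinear≋iteratedExtend u v)

    bilinear-cong : ∀ {u u′ v v′} → u ≋ u′ → v ≋ v′ → bilinear u v ≋ bilinear u′ v′
    bilinear-cong {u} {u′} {v} {v′} (∼⇒≋ u∼u′) (∼⇒≋ v∼v′) = begin
      bilinear u v          ≈⟨ bilinear≋iteratedExtend u v ⟩
      iteratedExtend u v    ≈⟨ ∼⇒≋ (extend-cong (Span R _≟_) _ {u} {u′} u∼u′) ⟩
      iteratedExtend u′ v   ≈⟨ ∼⇒≋ (extend-cong-basis (Span R _≟_)
                                     (λ y → extend-cong (Span R _≟_) _ {v} {v′} v∼v′) u′) ⟩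
      iteratedExtend u′ v′  ≈⟨ bilinear≋iteratedExtend u′ v′ ⟨
      bilinear u′ v′        ∎

    bilinear-distribˡ : ∀ u v w → bilinear u (v ++ w) ≋ bilinear u v ++ bilinear u w
    bilinear-distribˡ []      v w = ≋-refl
    bilinear-distribˡ (p ∷ u) v w = begin
      row p (v ++ w) ++ bilinear u (v ++ w)                   ≈⟨ ≋-++ (≋-reflexive (map-++ _ v w)) (bilinear-distribˡ u v w) ⟩
      -- The two sides list the same terms in different orders, so they agree as combinations but
      -- not in general as lists.
      (row p v ++ row p w) ++ (bilinear u v ++ bilinear u w)  ≈⟨ ∼⇒≋ (interchange (row p v) _ _ _) ⟩
      (row p v ++ bilinear u v) ++ (row p w ++ bilinear u w)  ∎
      where
      open CommutativeSemigroupProperties (CommutativeMonoid.commutativeSemigroup V.+ᴹ-commutativeMonoid)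
        using (interchange)

    row-scaleˡ : ∀ k l y v → row (k * l , y) v ≋ scale R _≟_ k (row (l , y) v)
    row-scaleˡ k l y []      = ≋-refl
    row-scaleˡ k l y (_ ∷ v) = ≋-∷ (*-assoc k l _) refl (row-scaleˡ k l y v)

    bilinear-scaleˡ : ∀ k u v → bilinear (scale R _≟_ k u) v ≋ scale R _≟_ k (bilinear u v)
    bilinear-scaleˡ k []            v = ≋-refl
    bilinear-scaleˡ k ((l , y) ∷ u) v = begin
      row (k * l , y) v ++ bilinear (scale R _≟_ k u) v                    ≈⟨ ≋-++ (row-scaleˡ k l y v) (bilinear-scaleˡ k u v) ⟩
      scale R _≟_ k (row (l , y) v) ++ scale R _≟_ k (bilinear u v)        ≡⟨ map-++ _ (row (l , y) v) (bilinear u v) ⟨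
      scale R _≟_ k (row (l , y) v ++ bilinear u v)                        ∎

    row-scaleʳ : ∀ k p v → row p (scale R _≟_ k v) ≋ scale R _≟_ k (row p v)
    row-scaleʳ k p       []      = ≋-refl
    row-scaleʳ k (l , y) (_ ∷ v) = ≋-∷ (x∙yz≈y∙xz l k _) refl (row-scaleʳ k (l , y) v)

    bilinear-scaleʳ : ∀ k u v → bilinear u (scale R _≟_ k v) ≋ scale R _≟_ k (bilinear u v)
    bilinear-scaleʳ k []      v = ≋-refl
    bilinear-scaleʳ k (p ∷ u) v = begin
      row p (scale R _≟_ k v) ++ bilinear u (scale R _≟_ k v)        ≈⟨ ≋-++ (row-scaleʳ k p v) (bilinear-scaleʳ k u v) ⟩
      scale R _≟_ k (row p v) ++ scale R _≟_ k (bilinear u v)        ≡⟨ map-++ _ (row p v) (bilinear u v) ⟨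
      scale R _≟_ k (row p v ++ bilinear u v)                        ∎

    bilinearExtension-isBilinear : IsBilinear (Span R _≟_) bilinear
    bilinearExtension-isBilinear = record
      { ∙-cong    = λ {u} {u′} {v} {v′} p q → ≋⇒∼ (bilinear-cong {u} {u′} {v} {v′} (∼⇒≋ p) (∼⇒≋ q))
      ; ∙-distrib = (λ u v w → ≋⇒∼ (bilinear-distribˡ u v w))
                  , (λ w u v → ≋⇒∼ (≋-reflexive (concatMap-++ _ u v)))
      ; ∙-*ₗˡ     = λ k u v → ≋⇒∼ (bilinear-scaleˡ k u v)
      ; ∙-*ₗʳ     = λ k u v → ≋⇒∼ (bilinear-scaleʳ k u v)
      }

  -- Each of the five axioms has this shape, which is why four operations are allowed. Both sides
  -- run through the triples of terms in the same lexicographic order, so they match term by term,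
  -- with `*-assoc` for the coefficients.
  bilinear-assoc : ∀ {f g f′ g′ : X → X → X} → (∀ x y z → f (g x y) z ≡ f′ x (g′ y z)) →
    ∀ u v w → bilinear f (bilinear g u v) w ≋ bilinear f′ u (bilinear g′ v w)
  bilinear-assoc {f} {g} {f′} {g′} assoc = outer
    where
    open ≈-Reasoning ≋-setoid

    innermost : ∀ k x l y w → row f (k * l , g x y) w ≋ row f′ (k , x) (row g′ (l , y) w)
    innermost k x l y []            = ≋-refl
    innermost k x l y ((i , z) ∷ w) = ≋-∷ (*-assoc k l i) (assoc x y z) (innermost k x l y w)

    inner : ∀ p v w → bilinear f (row g p v) w ≋ row f′ p (bilinear g′ v w)
    inner p         []            w = ≋-refl
    inner p@(k , x) ((l , y) ∷ v) w = begin
      row f (k * l , g x y) w ++ bilinear f (row g p v) w           ≈⟨ ≋-++ (innermost k x l y w) (inner p v w) ⟩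
      row f′ p (row g′ (l , y) w) ++ row f′ p (bilinear g′ v w)     ≡⟨ map-++ _ (row g′ (l , y) w) (bilinear g′ v w) ⟨
      row f′ p (row g′ (l , y) w ++ bilinear g′ v w)                ∎

    outer : ∀ u v w → bilinear f (bilinear g u v) w ≋ bilinear f′ u (bilinear g′ v w)
    outer []      v w = ≋-refl
    outer (p ∷ u) v w = begin
      bilinear f (row g p v ++ bilinear g u v) w                       ≡⟨ concatMap-++ _ (row g p v) (bilinear g u v) ⟩
      bilinear f (row g p v) w ++ bilinear f (bilinear g u v) w        ≈⟨ ≋-++ (inner p v w) (outer u v w) ⟩
      row f′ p (bilinear g′ v w) ++ bilinear f′ u (bilinear g′ v w)    ∎

  -- Linear extensions and bilinear products

  module _ (M : Module R m ℓm) {_∙_ : Module.Carrierᴹ M → Module.Carrierᴹ M → Module.Carrierᴹ M}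
           (∙-bilinear : IsBilinear M _∙_) where
    open Module M
    open IsBilinear ∙-bilinear
    open ≈-Reasoning ≈ᴹ-setoid

    -- Writing the zero as `0# *ₗ 0ᴹ` lets compatibility with scalars pull the factor `0#` out of
    -- the product.
    ∙-zeroˡ : ∀ y → (0ᴹ ∙ y) ≈ᴹ 0ᴹ
    ∙-zeroˡ y = begin
      0ᴹ ∙ y           ≈⟨ ∙-cong (*ₗ-zeroˡ 0ᴹ) ≈ᴹ-refl ⟨
      (0# *ₗ 0ᴹ) ∙ y   ≈⟨ ∙-*ₗˡ 0# 0ᴹ y ⟩
      0# *ₗ (0ᴹ ∙ y)   ≈⟨ *ₗ-zeroˡ _ ⟩
      0ᴹ               ∎

    ∙-zeroʳ : ∀ x → (x ∙ 0ᴹ) ≈ᴹ 0ᴹ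
    ∙-zeroʳ x = begin
      x ∙ 0ᴹ           ≈⟨ ∙-cong ≈ᴹ-refl (*ₗ-zeroˡ 0ᴹ) ⟨
      x ∙ (0# *ₗ 0ᴹ)   ≈⟨ ∙-*ₗʳ 0# x 0ᴹ ⟩
      0# *ₗ (x ∙ 0ᴹ)   ≈⟨ *ₗ-zeroˡ _ ⟩
      0ᴹ               ∎

    -- By bilinearity, multiplicativity need only be checked on basis elements: `rows` expands the
    -- right argument, `outer` the left one.
    extend-homo : ∀ {f : X → Carrierᴹ} {g : X → X → X} → (∀ x y → f (g x y) ≈ᴹ (f x ∙ f y)) →
      ∀ u v → extend M f (bilinear g u v) ≈ᴹ (extend M f u ∙ extend M f v)
    extend-homo {f} {g} homo = outer
      where
      open LinearExtension M f using (extend-++)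

      rows : ∀ k x v → extend M f (row g (k , x) v) ≈ᴹ ((k *ₗ f x) ∙ extend M f v)
      rows k x []            = ≈ᴹ-sym (∙-zeroʳ _)
      rows k x ((l , y) ∷ v) = begin
        (k * l) *ₗ f (g x y) +ᴹ extend M f (row g (k , x) v)               ≈⟨ +ᴹ-cong (*ₗ-congˡ (homo x y)) (rows k x v) ⟩
        (k * l) *ₗ (f x ∙ f y) +ᴹ ((k *ₗ f x) ∙ extend M f v)              ≈⟨ +ᴹ-congʳ (*ₗ-assoc k l _) ⟩
        k *ₗ (l *ₗ (f x ∙ f y)) +ᴹ ((k *ₗ f x) ∙ extend M f v)             ≈⟨ +ᴹ-congʳ (*ₗ-congˡ (∙-*ₗʳ l _ _)) ⟨
        k *ₗ (f x ∙ (l *ₗ f y)) +ᴹ ((k *ₗ f x) ∙ extend M f v)             ≈⟨ +ᴹ-congʳ (∙-*ₗˡ k _ _) ⟨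
        ((k *ₗ f x) ∙ (l *ₗ f y)) +ᴹ ((k *ₗ f x) ∙ extend M f v)           ≈⟨ proj₁ ∙-distrib _ _ _ ⟨
        (k *ₗ f x) ∙ (l *ₗ f y +ᴹ extend M f v)                            ∎

      outer : ∀ u v → extend M f (bilinear g u v) ≈ᴹ (extend M f u ∙ extend M f v)
      outer []            v = ≈ᴹ-sym (∙-zeroˡ _)
      outer ((k , x) ∷ u) v = begin
        extend M f (row g (k , x) v ++ bilinear g u v)                          ≈⟨ extend-++ (row g (k , x) v) _ ⟩
        extend M f (row g (k , x) v) +ᴹ extend M f (bilinear g u v)             ≈⟨ +ᴹ-cong (rows k x v) (outer u v) ⟩
        ((k *ₗ f x) ∙ extend M f v) +ᴹ (extend M f u ∙ extend M f v)         ≈⟨ proj₂ ∙-distrib _ _ _ ⟨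
        (k *ₗ f x +ᴹ extend M f u) ∙ extend M f v                            ∎

-- Raising letters

module _ {γ : ℕ} where
  open Max (Fin.≤-totalOrder γ) using (⊔-assoc; x≤y⇒x⊔y≈y; x≤y⇒y⊔x≈y)

  -- Connects the comparison that defines `h` with the maximum `_↑_` that occurs in the axioms.
  h-fsuc : ∀ (a b : Fin γ) u → h a (fsuc b ∷ u) ≡ fsuc (a ↑ b) ∷ h a u
  h-fsuc a b u = cong (_∷ h a u) (raise b<a?)
    where
    b<a? = fsuc b Fin.<? fsuc a
    raise : Dec (fsuc b <ᶠ fsuc a) → (if does b<a? then fsuc a else fsuc b) ≡ fsuc (a ↑ b)
    raise (yes b<a) = trans (cong (if_then fsuc a else fsuc b) (dec-true b<a? b<a))
                            (cong fsuc (sym (x≤y⇒y⊔x≈y (<⇒≤ (s≤s⁻¹ b<a)))))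
    raise (no b≮a)  = trans (cong (if_then fsuc a else fsuc b) (dec-false b<a? b≮a))
                            (cong fsuc (sym (x≤y⇒x⊔y≈y (≮⇒≥ (b≮a ∘ s≤s)))))

  -- On a nonzero letter this is associativity of the maximum; a 0 is first turned into `b`, then
  -- into `a ↑ b`. Every axiom with `↑` in it rests on this identity for words.
  h-h : ∀ (a b : Fin γ) u → h a (h b u) ≡ h (a ↑ b) u
  h-h a b []           = refl
  h-h a b (zero ∷ u)   = trans (h-fsuc a b (h b u)) (cong (fsuc (a ↑ b) ∷_) (h-h a b u))
  h-h a b (fsuc c ∷ u) = begin
    h a (h b (fsuc c ∷ u))               ≡⟨ cong (h a) (h-fsuc b c u) ⟩
    h a (fsuc (b ↑ c) ∷ h b u)           ≡⟨ h-fsuc a (b ↑ c) (h b u) ⟩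
    fsuc (a ↑ (b ↑ c)) ∷ h a (h b u)     ≡⟨ cong₂ (λ d v → fsuc d ∷ v) (sym (⊔-assoc a b c)) (h-h a b u) ⟩
    fsuc ((a ↑ b) ↑ c) ∷ h (a ↑ b) u     ≡⟨ h-fsuc (a ↑ b) c u ⟨
    h (a ↑ b) (fsuc c ∷ u)               ∎
    where open ≡-Reasoning

  h-++ : ∀ (a : Fin γ) u v → h a (u ++ v) ≡ h a u ++ h a v
  h-++ a = map-++ _

  letters-injective : ∀ {u v : Word γ} → letters u ≡ letters v → u ≡ v
  letters-injective {word _ p} {word _ q} refl = cong (word _) (≡-irrelevant p q)

  -- The pluriassociative axioms for words

  wordSpace-isPluriassociative : (R : CommutativeRing c ℓ) →
    IsPluriassociative (WordSpace R γ) (wordLeft R γ) (wordRight R γ)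
  wordSpace-isPluriassociative R = record
    { ⊣-bilinear = λ a → bilinearExtension-isBilinear R _≟ʷ_ (_⊣ʷ⟨ a ⟩_)
    ; ⊢-bilinear = λ a → bilinearExtension-isBilinear R _≟ʷ_ (_⊢ʷ⟨ a ⟩_)
    ; ⊢-⊣-assoc  = λ a a′ → lift λ (word x _) (word y _) (word z _) → ++-assoc (h a′ x) y (h a z)
    ; ⊣↑-⊣       = λ a a′ → lift λ (word x _) (word y _) (word z _) → trans (++-assoc x _ _) (cong (x ++_)
        (sym (trans (h-++ a (h a′ y) z) (cong (_++ h a z) (h-h a a′ y)))))
    ; ⊣-⊢        = λ a a′ → lift λ (word x _) (word y _) (word z _) → trans (cong (_++ z)
        (trans (h-++ a x (h a′ y)) (cong (h a x ++_) (h-h a a′ y)))) (++-assoc (h a x) _ z)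
    ; ⊣-⊣↑       = λ a a′ → lift λ (word x _) (word y _) (word z _) → trans (++-assoc x _ _) (cong (x ++_)
        (sym (trans (h-++ a y (h a′ z)) (cong (h a y ++_) (h-h a a′ z)))))
    ; ⊢-⊢        = λ a a′ → lift λ (word x _) (word y _) (word z _) → trans (cong (_++ z)
        (trans (h-++ a (h a′ x) y) (cong (_++ h a y) (h-h a a′ x)))) (++-assoc (h (a ↑ a′) x) _ z)
    }
    where
    -- A word is determined by its letters, so each axiom reduces to an identity of lists.
    lift : {f g f′ g′ : Word γ → Word γ → Word γ} →
      (∀ x y z → letters (f (g x y) z) ≡ letters (f′ x (g′ y z))) →
      let bilin = bilinearExtension R _≟ʷ_ in
      ∀ u v w → _∼_ R _≟ʷ_ (bilin f (bilin g u v) w) (bilin f′ u (bilin g′ v w))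
    lift eq u v w = _≋_.≋⇒∼ (bilinear-assoc R _≟ʷ_ (λ x y z → letters-injective (eq x y z)) u v w)

-- Evaluating words at an element of an algebra

module Evaluation {R : CommutativeRing c ℓ} {γ : ℕ} (B : PluriassociativeAlgebra R γ m ℓm)
                  (b : PluriassociativeAlgebra.Carrierᴹ B) where
  open PluriassociativeAlgebra B
  open ≈-Reasoning ≈ᴹ-setoid

  ⊣-cong : ∀ {a x x′ y y′} → x ≈ᴹ x′ → y ≈ᴹ y′ → (x ⊣⟨ a ⟩ y) ≈ᴹ (x′ ⊣⟨ a ⟩ y′)
  ⊣-cong {a} = IsBilinear.∙-cong (⊣-bilinear a)

  ⊢-cong : ∀ {a x x′ y y′} → x ≈ᴹ x′ → y ≈ᴹ y′ → (x ⊢⟨ a ⟩ y) ≈ᴹ (x′ ⊢⟨ a ⟩ y′)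
  ⊢-cong {a} = IsBilinear.∙-cong (⊢-bilinear a)

  -- Junk values, never reached on words with exactly one 0: evalAfter at a letter 0, eval at [].

  evalAfter : Carrierᴹ → List (Letter γ) → Carrierᴹ
  evalAfter z []           = z
  evalAfter z (zero ∷ v)   = evalAfter z v
  evalAfter z (fsuc c ∷ v) = evalAfter (z ⊣⟨ c ⟩ b) v

  eval : List (Letter γ) → Carrierᴹ
  eval []           = b
  eval (zero ∷ v)   = evalAfter b v
  eval (fsuc c ∷ u) = b ⊢⟨ c ⟩ eval u

  evalAfter-cong : ∀ {y z} v → y ≈ᴹ z → evalAfter y v ≈ᴹ evalAfter z v
  evalAfter-cong []           y≈z = y≈z
  evalAfter-cong (zero ∷ v)   y≈z = evalAfter-cong v y≈z
  evalAfter-cong (fsuc c ∷ v) y≈z = evalAfter-cong v (⊣-cong y≈z ≈ᴹ-refl)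

  evalAfter-++ : ∀ z v w → evalAfter z (v ++ w) ≡ evalAfter (evalAfter z v) w
  evalAfter-++ z []           w = refl
  evalAfter-++ z (zero ∷ v)   w = evalAfter-++ z v w
  evalAfter-++ z (fsuc c ∷ v) w = evalAfter-++ (z ⊣⟨ c ⟩ b) v w

  -- Letters behind the 0 multiply on the right by `⊣`, letters in front of it on the left by `⊢`;
  -- `⊢-⊣-assoc` makes the two actions commute.
  evalAfter-⊢ : ∀ a y z w → evalAfter (y ⊢⟨ a ⟩ z) w ≈ᴹ (y ⊢⟨ a ⟩ evalAfter z w)
  evalAfter-⊢ a y z []           = ≈ᴹ-refl
  evalAfter-⊢ a y z (zero ∷ w)   = evalAfter-⊢ a y z w
  evalAfter-⊢ a y z (fsuc c ∷ w) =
    ≈ᴹ-trans (evalAfter-cong w (⊢-⊣-assoc c a y z b)) (evalAfter-⊢ a y (z ⊣⟨ c ⟩ b) w)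

  -- The hypothesis guarantees that the recursion reaches a 0 in `u`, from where `w` merely
  -- continues `evalAfter`. The letters in front of that 0 are passed by `evalAfter-⊢`.
  eval-++ : ∀ u w → zeros u ≡ 1 → eval (u ++ w) ≈ᴹ evalAfter (eval u) w
  eval-++ (zero ∷ v)   w _  = ≈ᴹ-reflexive (evalAfter-++ b v w)
  eval-++ (fsuc c ∷ u) w u₁ =
    ≈ᴹ-trans (⊢-cong ≈ᴹ-refl (eval-++ u w u₁)) (≈ᴹ-sym (evalAfter-⊢ c b (eval u) w))

  -- `⊣-⊣↑` moves the letters of `v` one by one into the right factor; the index `a ↑ c` that it
  -- requires is the letter that `h a` makes of `c`.
  evalAfter-h : ∀ a y z v → zeros v ≡ 0 → evalAfter (y ⊣⟨ a ⟩ z) (h a v) ≈ᴹ (y ⊣⟨ a ⟩ evalAfter z v)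
  evalAfter-h a y z []           _  = ≈ᴹ-refl
  evalAfter-h a y z (fsuc c ∷ v) v₀ = begin
    evalAfter (y ⊣⟨ a ⟩ z) (h a (fsuc c ∷ v))              ≡⟨ cong (evalAfter _) (h-fsuc a c v) ⟩
    evalAfter ((y ⊣⟨ a ⟩ z) ⊣⟨ a ↑ c ⟩ b) (h a v)          ≈⟨ evalAfter-cong (h a v) (⊣-⊣↑ a c y z b) ⟩
    evalAfter (y ⊣⟨ a ⟩ (z ⊣⟨ c ⟩ b)) (h a v)              ≈⟨ evalAfter-h a y (z ⊣⟨ c ⟩ b) v v₀ ⟩
    y ⊣⟨ a ⟩ evalAfter (z ⊣⟨ c ⟩ b) v                      ∎

  -- The letters in front of the 0 of `v` are absorbed by `⊣↑-⊣`, those behind it by `evalAfter-h`.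
  evalAfter-h-eval : ∀ a y v → zeros v ≡ 1 → evalAfter y (h a v) ≈ᴹ (y ⊣⟨ a ⟩ eval v)
  -- `h a` turns the 0 into the letter `a`, so the remaining letters act on `y ⊣⟨ a ⟩ b`.
  evalAfter-h-eval a y (zero ∷ v)   v₁ = evalAfter-h a y b v (suc-injective v₁)
  evalAfter-h-eval a y (fsuc c ∷ v) v₁ = begin
    evalAfter y (h a (fsuc c ∷ v))               ≡⟨ cong (evalAfter y) (h-fsuc a c v) ⟩
    evalAfter (y ⊣⟨ a ↑ c ⟩ b) (h a v)           ≈⟨ evalAfter-h-eval a _ v v₁ ⟩
    (y ⊣⟨ a ↑ c ⟩ b) ⊣⟨ a ⟩ eval v               ≈⟨ ⊣↑-⊣ a c y b (eval v) ⟩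
    y ⊣⟨ a ⟩ (b ⊢⟨ c ⟩ eval v)                   ∎

  eval-⊣ : ∀ a (u v : Word γ) →
    eval (letters (u ⊣ʷ⟨ a ⟩ v)) ≈ᴹ (eval (letters u) ⊣⟨ a ⟩ eval (letters v))
  eval-⊣ a (word u u₁) (word v v₁) = ≈ᴹ-trans (eval-++ u (h a v) u₁) (evalAfter-h-eval a (eval u) v v₁)

  -- Letters behind the 0 of the left factor end up in front of the 0 of the product, hence change
  -- from `⊣` to `⊢`. The axiom `⊣-⊢` performs this exchange for one letter.
  evalAfter-⊢-h : ∀ a z u v → zeros u ≡ 0 → (z ⊢⟨ a ⟩ eval (h a u ++ v)) ≈ᴹ (evalAfter z u ⊢⟨ a ⟩ eval v)
  evalAfter-⊢-h a z []           v _  = ≈ᴹ-refl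
  evalAfter-⊢-h a z (fsuc c ∷ u) v u₀ = begin
    z ⊢⟨ a ⟩ eval (h a (fsuc c ∷ u) ++ v)            ≡⟨ cong (λ w → z ⊢⟨ a ⟩ eval (w ++ v)) (h-fsuc a c u) ⟩
    z ⊢⟨ a ⟩ (b ⊢⟨ a ↑ c ⟩ eval (h a u ++ v))        ≈⟨ ⊣-⊢ a c z b _ ⟨
    (z ⊣⟨ c ⟩ b) ⊢⟨ a ⟩ eval (h a u ++ v)            ≈⟨ evalAfter-⊢-h a (z ⊣⟨ c ⟩ b) u v u₀ ⟩
    evalAfter (z ⊣⟨ c ⟩ b) u ⊢⟨ a ⟩ eval v           ∎

  -- The letters in front of the 0 of `u` are collected by `⊢-⊢`. The 0 itself becomes the letter
  -- `a`, that is, a factor `b ⊢⟨ a ⟩`, from which `evalAfter-⊢-h` starts.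
  eval-h-++ : ∀ a u v → zeros u ≡ 1 → eval (h a u ++ v) ≈ᴹ (eval u ⊢⟨ a ⟩ eval v)
  eval-h-++ a (zero ∷ u)   v u₁ = evalAfter-⊢-h a b u v (suc-injective u₁)
  eval-h-++ a (fsuc c ∷ u) v u₁ = begin
    eval (h a (fsuc c ∷ u) ++ v)                ≡⟨ cong (λ w → eval (w ++ v)) (h-fsuc a c u) ⟩
    b ⊢⟨ a ↑ c ⟩ eval (h a u ++ v)              ≈⟨ ⊢-cong ≈ᴹ-refl (eval-h-++ a u v u₁) ⟩
    b ⊢⟨ a ↑ c ⟩ (eval u ⊢⟨ a ⟩ eval v)         ≈⟨ ⊢-⊢ a c b (eval u) (eval v) ⟨
    (b ⊢⟨ c ⟩ eval u) ⊢⟨ a ⟩ eval v             ∎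

  eval-⊢ : ∀ a (u v : Word γ) →
    eval (letters (u ⊢ʷ⟨ a ⟩ v)) ≈ᴹ (eval (letters u) ⊢⟨ a ⟩ eval (letters v))
  eval-⊢ a (word u u₁) (word v _) = eval-h-++ a u v u₁

-- The universal property

zeroWord : ∀ {γ} → Word γ
zeroWord = word (zero ∷ []) refl

module _ (R : CommutativeRing c ℓ) (γ : ℕ) where
  open CommutativeRing R using (1#; _*_; *-identityˡ) renaming (sym to ≈-sym; refl to ≈-refl)

  wordAlgebra : PluriassociativeAlgebra R γ _ _
  wordAlgebra = record { isPluriassociative = wordSpace-isPluriassociative {γ = γ} R }

  private
    module W = PluriassociativeAlgebra wordAlgebra

    ⟪_⟫ : Word γ → W.Carrierᴹ
    ⟪ w ⟫ = [ 1# , w ]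

  module _ (B : PluriassociativeAlgebra R γ m ℓm) (b : PluriassociativeAlgebra.Carrierᴹ B) where
    open PluriassociativeAlgebra B
    open Evaluation B b
    open LinearExtension R _≟ʷ_ space (eval ∘ letters) using (extend; extend-isLinear; extend-unique)

    extend-isHomomorphism : IsHomomorphism wordAlgebra B extend
    extend-isHomomorphism = record
      { isLinear = extend-isLinear
      ; ⊣-homo   = λ a → extend-homo R _≟ʷ_ space (⊣-bilinear a) (eval-⊣ a)
      ; ⊢-homo   = λ a → extend-homo R _≟ʷ_ space (⊢-bilinear a) (eval-⊢ a)
      }

    extend-generator : extend ⟪ zeroWord ⟫ ≈ᴹ b
    extend-generator = ≈ᴹ-trans (+ᴹ-identityʳ _) (*ₗ-identityˡ b)

    module _ {ψ : W.Carrierᴹ → Carrierᴹ} (ψ-homo : IsHomomorphism wordAlgebra B ψ)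
             (ψ-generator : ψ ⟪ zeroWord ⟫ ≈ᴹ b) where
      open IsHomomorphism ψ-homo
      open IsModuleHomomorphism isLinear using (⟦⟧-cong)
      open ≈-Reasoning ≈ᴹ-setoid

      ψ-⟪⟫-cong : ∀ {u v} → letters u ≡ letters v → ψ ⟪ u ⟫ ≈ᴹ ψ ⟪ v ⟫
      ψ-⟪⟫-cong eq = ≈ᴹ-reflexive (cong (ψ ∘ ⟪_⟫) (letters-injective eq))

      -- The product of two basis elements in the word algebra carries the coefficient `1# * 1#`.
      ψ-1*1 : ∀ w → ψ ⟪ w ⟫ ≈ᴹ ψ [ 1# * 1# , w ]
      ψ-1*1 w = ⟦⟧-cong (∷-cong R _≟ʷ_ {x = w} {u = []} {[]} (≈-sym (*-identityˡ 1#)) refl λ _ → ≈-refl)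

      ψ-⊣ : ∀ a u v → ψ ⟪ u ⊣ʷ⟨ a ⟩ v ⟫ ≈ᴹ (ψ ⟪ u ⟫ ⊣⟨ a ⟩ ψ ⟪ v ⟫)
      ψ-⊣ a u v = ≈ᴹ-trans (ψ-1*1 (u ⊣ʷ⟨ a ⟩ v)) (⊣-homo a ⟪ u ⟫ ⟪ v ⟫)

      ψ-⊢ : ∀ a u v → ψ ⟪ u ⊢ʷ⟨ a ⟩ v ⟫ ≈ᴹ (ψ ⟪ u ⟫ ⊢⟨ a ⟩ ψ ⟪ v ⟫)
      ψ-⊢ a u v = ≈ᴹ-trans (ψ-1*1 (u ⊢ʷ⟨ a ⟩ v)) (⊢-homo a ⟪ u ⟫ ⟪ v ⟫)

      -- Here `u` is the part of the word already read and `z` the value of `ψ` on it. Reading a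
      -- letter `c` replaces `u` by its product under `⊣⟨ c ⟩` with the generator, whose 0 is raised
      -- to `c`. Quantifying over `p` accommodates whichever proof of the zero count the caller
      -- holds.
      ψ-evalAfter : ∀ (u : Word γ) v {z} → zeros v ≡ 0 → ψ ⟪ u ⟫ ≈ᴹ z →
        ∀ p → ψ ⟪ word (letters u ++ v) p ⟫ ≈ᴹ evalAfter z v
      ψ-evalAfter u []           {z} _  ψu p =
        ≈ᴹ-trans (ψ-⟪⟫-cong (++-identityʳ (letters u))) ψu
      ψ-evalAfter u (fsuc c ∷ v) {z} v₀ ψu p = begin
        ψ ⟪ word (letters u ++ fsuc c ∷ v) p ⟫           ≈⟨ ψ-⟪⟫-cong {v = word (letters uc ++ v) (trans (cong zeros assoc) p)} (sym assoc) ⟩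
        ψ ⟪ word (letters uc ++ v) _ ⟫                   ≈⟨ ψ-evalAfter uc v v₀ ψuc _ ⟩
        evalAfter (z ⊣⟨ c ⟩ b) v                         ∎
        where
        uc : Word γ
        uc = u ⊣ʷ⟨ c ⟩ zeroWord
        assoc : (letters u ++ fsuc c ∷ []) ++ v ≡ letters u ++ fsuc c ∷ v
        assoc = ++-assoc (letters u) (fsuc c ∷ []) v
        ψuc : ψ ⟪ uc ⟫ ≈ᴹ (z ⊣⟨ c ⟩ b)
        ψuc = ≈ᴹ-trans (ψ-⊣ c u zeroWord) (⊣-cong ψu ψ-generator)

      ψ-eval : ∀ u p → ψ ⟪ word u p ⟫ ≈ᴹ eval u
      ψ-eval (zero ∷ v)   p = ψ-evalAfter zeroWord v (suc-injective p) ψ-generator p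
      ψ-eval (fsuc c ∷ u) p = begin
        -- Raising the 0 of the generator gives the letter `c`, so both words have the same letters
        -- by computation; only their proofs of the zero count may differ.
        ψ ⟪ word (fsuc c ∷ u) p ⟫             ≈⟨ ψ-⟪⟫-cong refl ⟩
        ψ ⟪ zeroWord ⊢ʷ⟨ c ⟩ word u p ⟫       ≈⟨ ψ-⊢ c zeroWord (word u p) ⟩
        ψ ⟪ zeroWord ⟫ ⊢⟨ c ⟩ ψ ⟪ word u p ⟫  ≈⟨ ⊢-cong ψ-generator (ψ-eval u p) ⟩
        b ⊢⟨ c ⟩ eval u                       ∎

      homomorphism-unique : ∀ u → extend u ≈ᴹ ψ u
      homomorphism-unique = extend-unique isLinear λ (word u p) → ψ-eval u p

  wordSpace-isFree : IsFreeOverOneGenerator (WordSpace R γ) (wordLeft R γ) (wordRight R γ)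
  wordSpace-isFree = record
    { isPluriassociative = wordSpace-isPluriassociative R
    ; generator          = ⟪ zeroWord ⟫
    ; universal          = λ B b →
        LinearExtension.extend R _≟ʷ_ (PluriassociativeAlgebra.space B) (Evaluation.eval B b ∘ letters)
        , (extend-isHomomorphism B b , extend-generator B b)
        , λ (ψ-homo , ψ-generator) → homomorphism-unique B b ψ-homo ψ-generator
    }

proposition3p1p1 : ∀ {c ℓ₁ ℓ₂} (K : HeytingField c ℓ₁ ℓ₂) → CharacteristicZero K → (γ : ℕ) →
    IsFreeOverOneGenerator (WordSpace (fieldRing K) γ) (wordLeft (fieldRing K) γ) (wordRight (fieldRing K) γ)
proposition3p1p1 K _ γ = wordSpace-isFree (fieldRing K) γ
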